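{- Let $G_1$ and $G_2$ be two vertex-disjoint simple connected graphs with $|V(G_1)|=n_1$, $|V(G_2)|=n_2$, $|E(G_1)|=m_1$, $|E(G_2)|=m_2$. Then the edge T-join $G_1\underline{\vee}_T G_2$ satisfies \[ F(G_1\underline{\vee}_T G_2)=8F(G_1)+F(G_2)+3n_2^{2}M_1(G_1)+3m_1M_1(G_2)+M_4(G_1)+3n_2\,HM(G_1)+3\,ReZM(G_1)+m_1^{2}(6m_2+m_1n_2)+m_1n_2^{3}. \]
   Context: For a simple graph $G$ and $v\in V(G)$, $d_G(v)$ is the degree of $v$. Define $M_1(G)=\sum_{v\in V(G)}d_G(v)^2$, $F(G)=\sum_{v\in V(G)}d_G(v)^3$, $M_4(G)=\sum_{v\in V(G)}d_G(v)^4$, $HM(G)=\sum_{uv\in E(G)}[d_G(u)+d_G(v)]^2$, and $ReZM(G)=\sum_{uv\in E(G)}d_G(u)d_G(v)\,[d_G(u)+d_G(v)]$. The total graph $T(G)$ is obtained from $G$ (keeping all edges of $G$) by inserting a new vertex for each edge of $G$, joining each new vertex to the two end vertices of its edge, and joining by an edge each pair of new vertices corresponding to adjacent edges of $G$ (edges sharing an end vertex); let $I(G)$ denote the set of these new vertices, so $V(T(G))=V(G)\cup I(G)$. The edge T-join $G_1\underline{\vee}_T G_2$ is the graph obtained from $T(G_1)$ and $G_2$ (taken vertex-disjoint) by joining each vertex of $I(G_1)$ to every vertex of $G_2$ by an edge. -}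

module Defs where

open import Data.Nat using (ℕ; _+_; _*_; _^_)
open import Data.Fin using (Fin)
open import Data.Nat.ListAction using (sum)
import Data.Fin.Properties as Fin
open import Data.List using (List; []; _∷_; _++_; map; filter; length; lookup; allFin)
open import Data.List.Membership.Propositional using (_∈_)
open import Data.List.Membership.Propositional.Properties using (∈-map⁺; ∈-map⁻; ∈-++⁺ˡ; ∈-++⁺ʳ; ∈-allFin)
open import Data.List.Relation.Unary.Unique.Propositional using (Unique)
import Data.List.Relation.Unary.Unique.Propositional.Properties as Unique
open import Data.Product using (∃; _×_; _,_; proj₁; proj₂)
open import Data.Sum using (_⊎_; inj₁; inj₂)
open import Data.Sum.Properties using (≡-dec; inj₁-injective; inj₂-injective)
open import Data.Empty using (⊥)
open import Data.Unit using (⊤; tt)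
open import Function using (_∘_)
open import Relation.Nullary using (Dec; yes; no; ¬?; _×-dec_; _⊎-dec_)
open import Relation.Nullary.Decidable using (map′)
open import Relation.Binary.Core using (Rel)
open import Relation.Binary.Definitions using (DecidableEquality; Decidable; Symmetric; Irreflexive)
open import Relation.Binary.Construct.Closure.ReflexiveTransitive using (Star)
open import Relation.Binary.PropositionalEquality using (_≡_; _≢_; refl; sym)
open import Level using (0ℓ)

-- For a list without repetitions, every two-element subset of its elements
-- is listed exactly once, as an ordered pair following the order of the list.
pairs : {A : Set} → List A → List (A × A)
pairs []       = []
pairs (x ∷ xs) = map (x ,_) xs ++ pairs xs

record SimpleGraph : Set₁ where
  field
    V          : Set
    _≟_        : DecidableEquality V
    vertices   : List V
    complete   : ∀ v → v ∈ vertices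
    unique     : Unique vertices
    Adj        : Rel V 0ℓ
    adj?       : Decidable Adj
    adj-sym    : Symmetric Adj
    adj-irrefl : Irreflexive _≡_ Adj

  edges : List (V × V)
  edges = filter (λ (u , v) → adj? u v) (pairs vertices)

  order : ℕ
  order = length vertices

  size : ℕ
  size = length edges

  degree : V → ℕ
  degree v = length (filter (adj? v) vertices)

  -- Walks of length zero are allowed; the graph without vertices counts as connected.
  Connected : Set
  Connected = ∀ u v → Star Adj u v

  -- An edge is a position in the repetition-free list of edges.
  E : Set
  E = Fin size

  _IsEndOf_ : V → E → Set
  v IsEndOf e = v ≡ proj₁ (lookup edges e) ⊎ v ≡ proj₂ (lookup edges e)

  isEndOf? : Decidable _IsEndOf_
  isEndOf? v e = (v ≟ proj₁ (lookup edges e)) ⊎-dec (v ≟ proj₂ (lookup edges e))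

  ShareEnd : E → E → Set
  ShareEnd e f = ∃ λ v → v IsEndOf e × v IsEndOf f

  shareEnd? : Decidable ShareEnd
  shareEnd? e f = map′ to from (isEndOf? a f ⊎-dec isEndOf? b f)
    where
    a b : V
    a = proj₁ (lookup edges e)
    b = proj₂ (lookup edges e)

    to : a IsEndOf f ⊎ b IsEndOf f → ShareEnd e f
    to (inj₁ p) = a , inj₁ refl , p
    to (inj₂ p) = b , inj₂ refl , p

    from : ShareEnd e f → a IsEndOf f ⊎ b IsEndOf f
    from (_ , inj₁ refl , p) = inj₁ p
    from (_ , inj₂ refl , p) = inj₂ p

module _ {A B : Set} {xs : List A} {ys : List B} where

  ⊎-complete : (∀ a → a ∈ xs) → (∀ b → b ∈ ys) →
               ∀ c → c ∈ map inj₁ xs ++ map inj₂ ys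
  ⊎-complete p q (inj₁ a) = ∈-++⁺ˡ (∈-map⁺ inj₁ (p a))
  ⊎-complete p q (inj₂ b) = ∈-++⁺ʳ (map inj₁ xs) (∈-map⁺ inj₂ (q b))

  ⊎-unique : Unique xs → Unique ys → Unique (map {B = A ⊎ B} inj₁ xs ++ map inj₂ ys)
  ⊎-unique p q =
    Unique.++⁺ (Unique.map⁺ inj₁-injective p) (Unique.map⁺ inj₂-injective q) disjoint
    where
    disjoint : ∀ {c} → c ∈ map inj₁ xs × c ∈ map inj₂ ys → ⊥
    disjoint (l , r) with ∈-map⁻ inj₁ l | ∈-map⁻ inj₂ r
    ... | _ , _ , refl | _ , _ , ()

-- The total graph T(G); the inserted vertices I(G) are those of the form inj₂ e.
totalGraph : SimpleGraph → SimpleGraph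
totalGraph G = record
  { V          = V ⊎ E
  ; _≟_        = ≡-dec _≟_ Fin._≟_
  ; vertices   = map inj₁ vertices ++ map inj₂ (allFin size)
  ; complete   = ⊎-complete complete ∈-allFin
  ; unique     = ⊎-unique unique (Unique.allFin⁺ size)
  ; Adj        = TAdj
  ; adj?       = tadj?
  ; adj-sym    = λ {x} {y} → tadj-sym x y
  ; adj-irrefl = λ { {x} refl → tadj-irrefl x }
  }
  where
  open SimpleGraph G

  TAdj : Rel (V ⊎ E) 0ℓ
  TAdj (inj₁ u) (inj₁ v) = Adj u v
  TAdj (inj₁ v) (inj₂ e) = v IsEndOf e
  TAdj (inj₂ e) (inj₁ v) = v IsEndOf e
  TAdj (inj₂ e) (inj₂ f) = e ≢ f × ShareEnd e f

  tadj? : Decidable TAdj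
  tadj? (inj₁ u) (inj₁ v) = adj? u v
  tadj? (inj₁ v) (inj₂ e) = isEndOf? v e
  tadj? (inj₂ e) (inj₁ v) = isEndOf? v e
  tadj? (inj₂ e) (inj₂ f) = ¬? (e Fin.≟ f) ×-dec shareEnd? e f

  tadj-sym : ∀ x y → TAdj x y → TAdj y x
  tadj-sym (inj₁ _) (inj₁ _) p = adj-sym p
  tadj-sym (inj₁ _) (inj₂ _) p = p
  tadj-sym (inj₂ _) (inj₁ _) p = p
  tadj-sym (inj₂ _) (inj₂ _) (e≢f , v , p , q) = e≢f ∘ sym , v , q , p

  tadj-irrefl : ∀ x → TAdj x x → ⊥
  tadj-irrefl (inj₁ _) p         = adj-irrefl refl p
  tadj-irrefl (inj₂ _) (e≢e , _) = e≢e refl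

infixl 6 _⊻ᵀ_

-- The edge T-join; taking the sum of the vertex types makes the two parts disjoint.
_⊻ᵀ_ : SimpleGraph → SimpleGraph → SimpleGraph
G₁ ⊻ᵀ G₂ = record
  { V          = T.V ⊎ H.V
  ; _≟_        = ≡-dec T._≟_ H._≟_
  ; vertices   = map inj₁ T.vertices ++ map inj₂ H.vertices
  ; complete   = ⊎-complete T.complete H.complete
  ; unique     = ⊎-unique T.unique H.unique
  ; Adj        = JAdj
  ; adj?       = jadj?
  ; adj-sym    = λ {x} {y} → jadj-sym x y
  ; adj-irrefl = λ { {x} refl → jadj-irrefl x }
  }
  where
  module T = SimpleGraph (totalGraph G₁)
  module H = SimpleGraph G₂

  Inserted : T.V → Set
  Inserted (inj₁ _) = ⊥
  Inserted (inj₂ _) = ⊤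

  inserted? : ∀ x → Dec (Inserted x)
  inserted? (inj₁ _) = no λ ()
  inserted? (inj₂ _) = yes tt

  JAdj : Rel (T.V ⊎ H.V) 0ℓ
  JAdj (inj₁ x) (inj₁ y) = T.Adj x y
  JAdj (inj₁ x) (inj₂ _) = Inserted x
  JAdj (inj₂ _) (inj₁ x) = Inserted x
  JAdj (inj₂ v) (inj₂ w) = H.Adj v w

  jadj? : Decidable JAdj
  jadj? (inj₁ x) (inj₁ y) = T.adj? x y
  jadj? (inj₁ x) (inj₂ _) = inserted? x
  jadj? (inj₂ _) (inj₁ x) = inserted? x
  jadj? (inj₂ v) (inj₂ w) = H.adj? v w

  jadj-sym : ∀ x y → JAdj x y → JAdj y x
  jadj-sym (inj₁ x) (inj₁ y) p = T.adj-sym {x} {y} p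
  jadj-sym (inj₁ _) (inj₂ _) p = p
  jadj-sym (inj₂ _) (inj₁ _) p = p
  jadj-sym (inj₂ _) (inj₂ _) p = H.adj-sym p

  jadj-irrefl : ∀ x → JAdj x x → ⊥
  jadj-irrefl (inj₁ x) p = T.adj-irrefl {x} refl p
  jadj-irrefl (inj₂ _) p = H.adj-irrefl refl p

module _ (G : SimpleGraph) where
  open SimpleGraph G

  M₁ : ℕ
  M₁ = sum (map (λ v → degree v ^ 2) vertices)

  F : ℕ
  F = sum (map (λ v → degree v ^ 3) vertices)

  M₄ : ℕ
  M₄ = sum (map (λ v → degree v ^ 4) vertices)

  HM : ℕ
  HM = sum (map (λ (u , v) → (degree u + degree v) ^ 2) edges)

  ReZM : ℕ
  ReZM = sum (map (λ (u , v) → degree u * degree v * (degree u + degree v)) edges)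

{-# OPTIONS --safe #-}

-- A vertex v of G₁ has degree 2 d(v) in the edge T-join, the vertex inserted
-- into the edge uv has degree d(u) + d(v) + n₂, and a vertex w of G₂ has degree
-- d(w) + m₁. It remains to expand the cubes and to use
-- Σ_{uv ∈ E} (f(u) + f(v)) = Σ_v d(v) f(v). That identity, the count of the
-- edges at a given vertex, and the fact that an edge is the only one with its
-- two ends are all instances of one double counting of ordered adjacent pairs
-- (∑-edges), applied to indicator functions.

module Submission where

open import Defs
open import Data.Nat using (ℕ; suc; _+_; _*_; _^_)
open import Data.Nat.Properties using (+-comm; +-assoc; +-identityʳ; *-comm; *-identityʳ; *-zeroʳ; *-distribˡ-+)
open import Data.Nat.ListAction using (sum)
open import Data.Nat.ListAction.Properties using (sum-++)
open import Data.Nat.Solver using (module +-*-Solver)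
open import Data.Nat.Tactic.RingSolver using (solve-∀)
open import Data.Bool using (if_then_else_)
import Data.Fin.Properties as Fin
open import Data.List using (List; []; _∷_; _++_; map; filter; length; lookup; allFin; tabulate)
open import Data.List.Properties using (map-++; map-∘; map-cong; map-tabulate; tabulate-lookup)
open import Data.List.Membership.Propositional using (_∈_; _∉_)
open import Data.List.Membership.Propositional.Properties using (∈-lookup; ∈-filter⁻; ∈-allFin)
open import Data.List.Relation.Unary.All as All using ()
open import Data.List.Relation.Unary.AllPairs using (_∷_)
open import Data.List.Relation.Unary.Any using (here; there)
open import Data.List.Relation.Unary.Unique.Propositional using (Unique)
import Data.List.Relation.Unary.Unique.Propositional.Properties as Unique
open import Data.Product using (_×_; _,_; proj₁; proj₂)
open import Data.Sum using (_⊎_; inj₁; inj₂)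
open import Function using (_∘_; id)
open import Relation.Nullary using (Dec; yes; no; ¬_; ¬?; _×-dec_; _⊎-dec_)
open import Relation.Nullary.Decidable using (does; dec-true; dec-false; does-⇔)
open import Function.Bundles using (mk⇔)
open import Relation.Binary.Definitions using (DecidableEquality)
open import Relation.Unary using (Pred) renaming (Decidable to Decidable₁)
open import Relation.Binary.PropositionalEquality
  using (_≡_; _≢_; refl; sym; trans; cong; cong₂; module ≡-Reasoning)
open import Level using (0ℓ)
open SimpleGraph using (order; size; Connected)

private
  variable
    A B P Q : Set

-- Finite sums over lists.

∑ : List A → (A → ℕ) → ℕ
∑ xs f = sum (map f xs)

∑-cong : ∀ {f g : A → ℕ} (xs : List A) → (∀ x → f x ≡ g x) → ∑ xs f ≡ ∑ xs g
∑-cong xs eq = cong sum (map-cong eq xs)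

∑-map : ∀ (h : A → B) (f : B → ℕ) xs → ∑ (map h xs) f ≡ ∑ xs (f ∘ h)
∑-map h f xs = cong sum (sym (map-∘ xs))

∑-++ : ∀ (f : A → ℕ) xs ys → ∑ (xs ++ ys) f ≡ ∑ xs f + ∑ ys f
∑-++ f xs ys = trans (cong sum (map-++ f xs ys)) (sum-++ (map f xs) (map f ys))

∑-⊎ : ∀ (f : A ⊎ B → ℕ) xs ys →
      ∑ (map inj₁ xs ++ map inj₂ ys) f ≡ ∑ xs (f ∘ inj₁) + ∑ ys (f ∘ inj₂)
∑-⊎ f xs ys = trans (∑-++ f (map inj₁ xs) (map inj₂ ys))
                    (cong₂ _+_ (∑-map inj₁ f xs) (∑-map inj₂ f ys))

-- Inserted vertices are positions in the edge list. With `xs` that list, a sum over inserted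
-- vertices becomes a sum over edges, where double counting applies.
∑-lookup : ∀ (xs : List A) (f : A → ℕ) → ∑ (allFin (length xs)) (f ∘ lookup xs) ≡ ∑ xs f
∑-lookup xs f = begin
  ∑ (allFin (length xs)) (f ∘ lookup xs)      ≡⟨ ∑-map (lookup xs) f (allFin (length xs)) ⟨
  ∑ (map (lookup xs) (allFin (length xs))) f  ≡⟨ cong (λ ys → ∑ ys f) (map-tabulate id (lookup xs)) ⟩
  ∑ (tabulate (lookup xs)) f                  ≡⟨ cong (λ ys → ∑ ys f) (tabulate-lookup xs) ⟩
  ∑ xs f                                      ∎
  where open ≡-Reasoning

∑-+ : ∀ (xs : List A) (f g : A → ℕ) → ∑ xs (λ x → f x + g x) ≡ ∑ xs f + ∑ xs g
∑-+ []       f g = refl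
∑-+ (x ∷ xs) f g rewrite ∑-+ xs f g = interchange (f x) (g x) (∑ xs f) (∑ xs g)
  where
  interchange : ∀ a b c d → a + b + (c + d) ≡ a + c + (b + d)
  interchange = solve-∀

∑-*ˡ : ∀ (xs : List A) c (f : A → ℕ) → ∑ xs (λ x → c * f x) ≡ c * ∑ xs f
∑-*ˡ []       c f = sym (*-zeroʳ c)
∑-*ˡ (x ∷ xs) c f rewrite ∑-*ˡ xs c f = sym (*-distribˡ-+ c (f x) (∑ xs f))

∑-*ʳ : ∀ (xs : List A) (f : A → ℕ) c → ∑ xs (λ x → f x * c) ≡ ∑ xs f * c
∑-*ʳ xs f c = trans (∑-cong xs λ x → *-comm (f x) c)
             (trans (∑-*ˡ xs c f) (*-comm c (∑ xs f)))

∑-const : ∀ (xs : List A) c → ∑ xs (λ _ → c) ≡ length xs * c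
∑-const []       c = refl
∑-const (x ∷ xs) c = cong (c +_) (∑-const xs c)

∑-zero : ∀ (xs : List A) → ∑ xs (λ _ → 0) ≡ 0
∑-zero xs = trans (∑-const xs 0) (*-zeroʳ (length xs))

-- Indicators of decidable propositions.

-- The Iverson bracket reads only the boolean `does d`, so deciders that compute to the same boolean
-- have the same indicator by definition.
⟦_⟧ : Dec P → ℕ
⟦ d ⟧ = if does d then 1 else 0

⟦⟧-true : (d : Dec P) → P → ⟦ d ⟧ ≡ 1
⟦⟧-true d p = cong (if_then 1 else 0) (dec-true d p)

⟦⟧-false : (d : Dec P) → ¬ P → ⟦ d ⟧ ≡ 0
⟦⟧-false d ¬p = cong (if_then 1 else 0) (dec-false d ¬p)

⟦⟧-cong : (p : Dec P) (q : Dec Q) → (P → Q) → (Q → P) → ⟦ p ⟧ ≡ ⟦ q ⟧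
⟦⟧-cong p q to from = cong (if_then 1 else 0) (does-⇔ (mk⇔ to from) p q)

⟦⟧-disjoint : (p : Dec P) (q : Dec Q) → (P → ¬ Q) → ⟦ p ⟧ * ⟦ q ⟧ ≡ 0
⟦⟧-disjoint (yes p) q disj = trans (+-identityʳ ⟦ q ⟧) (⟦⟧-false q (disj p))
⟦⟧-disjoint (no _)  q disj = refl

-- Inclusion-exclusion, with the overlap added on the left because subtraction on `ℕ` truncates.
⟦⟧-⊎ : (p : Dec P) (q : Dec Q) → ⟦ p ⊎-dec q ⟧ + ⟦ p ⟧ * ⟦ q ⟧ ≡ ⟦ p ⟧ + ⟦ q ⟧
⟦⟧-⊎ (yes _) (yes _) = refl
⟦⟧-⊎ (yes _) (no _)  = refl
⟦⟧-⊎ (no _)  (yes _) = refl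
⟦⟧-⊎ (no _)  (no _)  = refl

⟦⟧-⊎-disjoint : (p : Dec P) (q : Dec Q) → (P → ¬ Q) → ⟦ p ⊎-dec q ⟧ ≡ ⟦ p ⟧ + ⟦ q ⟧
⟦⟧-⊎-disjoint p q disj = begin
  ⟦ p ⊎-dec q ⟧                  ≡⟨ +-identityʳ _ ⟨
  ⟦ p ⊎-dec q ⟧ + 0              ≡⟨ cong (⟦ p ⊎-dec q ⟧ +_) (⟦⟧-disjoint p q disj) ⟨
  ⟦ p ⊎-dec q ⟧ + ⟦ p ⟧ * ⟦ q ⟧  ≡⟨ ⟦⟧-⊎ p q ⟩
  ⟦ p ⟧ + ⟦ q ⟧                  ∎
  where open ≡-Reasoning

-- Since `P` implies `Q`, the cases of `Q` split into those with `P` and those without; again stated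
-- without subtraction.
⟦⟧-remove : (p : Dec P) (q : Dec Q) → (P → Q) → ⟦ ¬? p ×-dec q ⟧ + ⟦ p ⟧ ≡ ⟦ q ⟧
⟦⟧-remove (yes p) q       imp = sym (⟦⟧-true q (imp p))
⟦⟧-remove (no _)  (yes _) imp = refl
⟦⟧-remove (no _)  (no _)  imp = refl

module _ {R : Pred A 0ℓ} (R? : Decidable₁ R) where

  ∑-filter : ∀ xs (f : A → ℕ) → ∑ (filter R? xs) f ≡ ∑ xs (λ x → ⟦ R? x ⟧ * f x)
  ∑-filter []       f = refl
  ∑-filter (x ∷ xs) f with R? x
  ... | yes _ = cong₂ _+_ (sym (+-identityʳ (f x))) (∑-filter xs f)
  ... | no  _ = ∑-filter xs f

  length-filter : ∀ xs → length (filter R? xs) ≡ ∑ xs (λ x → ⟦ R? x ⟧)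
  length-filter []       = refl
  length-filter (x ∷ xs) with R? x
  ... | yes _ = cong suc (length-filter xs)
  ... | no  _ = length-filter xs

-- Sums against a Kronecker delta, and sums over pairs.

module _ (_≟_ : DecidableEquality A) where

  ∑-δ-∉ : ∀ {a xs} (f : A → ℕ) → a ∉ xs → ∑ xs (λ x → ⟦ a ≟ x ⟧ * f x) ≡ 0
  ∑-δ-∉ {xs = []}         f a∉ = refl
  ∑-δ-∉ {a} {xs = x ∷ xs} f a∉
    rewrite ⟦⟧-false (a ≟ x) (a∉ ∘ here) = ∑-δ-∉ f (a∉ ∘ there)

  -- Membership supplies a position where the delta is nonzero, and uniqueness excludes a second
  -- one.
  ∑-δ : ∀ {a xs} (f : A → ℕ) → Unique xs → a ∈ xs → ∑ xs (λ x → ⟦ a ≟ x ⟧ * f x) ≡ f a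
  ∑-δ {a} {_ ∷ xs} f (a≢ ∷ _) (here refl)
    rewrite ⟦⟧-true (a ≟ a) refl
          | ∑-δ-∉ f (λ a∈ → All.lookup a≢ a∈ refl) = trans (+-identityʳ _) (+-identityʳ (f a))
  ∑-δ {a} {x ∷ xs} f (x≢ ∷ uniq) (there a∈)
    rewrite ⟦⟧-false (a ≟ x) (λ a≡x → All.lookup x≢ a∈ (sym a≡x)) = ∑-δ f uniq a∈

  ∑-δ₁ : ∀ {a xs} → Unique xs → a ∈ xs → ∑ xs (λ x → ⟦ a ≟ x ⟧) ≡ 1
  ∑-δ₁ {a} {xs} uniq a∈ =
    trans (∑-cong xs λ x → sym (*-identityʳ ⟦ a ≟ x ⟧)) (∑-δ (λ _ → 1) uniq a∈)

-- The square of ordered pairs is its diagonal and two triangles; `pairs` runs through one triangle,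
-- and `k v u` covers the mirrored one. The induction peels off the row `ρ` and the column `κ` of
-- the head.
∑-pairs : ∀ (xs : List A) (k : A → A → ℕ) →
  ∑ (pairs xs) (λ (u , v) → k u v + k v u) + ∑ xs (λ x → k x x) ≡ ∑ xs (λ u → ∑ xs (k u))
∑-pairs []       k = refl
∑-pairs (x ∷ xs) k = begin
  ∑ (map (x ,_) xs ++ pairs xs) s + (k x x + D)  ≡⟨ cong (_+ (k x x + D)) (∑-++ s (map (x ,_) xs) (pairs xs)) ⟩
  ∑ (map (x ,_) xs) s + S + (k x x + D)          ≡⟨ cong (λ t → t + S + (k x x + D)) row+column ⟩
  ρ + κ + S + (k x x + D)                        ≡⟨ regroup ρ κ S (k x x) D ⟩
  k x x + ρ + (κ + (S + D))                      ≡⟨ cong (λ t → k x x + ρ + (κ + t)) (∑-pairs xs k) ⟩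
  k x x + ρ + (κ + ∑ xs (λ u → ∑ xs (k u)))      ≡⟨ cong (k x x + ρ +_) (∑-+ xs (λ u → k u x) (λ u → ∑ xs (k u))) ⟨
  k x x + ρ + ∑ xs (λ u → k u x + ∑ xs (k u))    ∎
  where
  open ≡-Reasoning
  s = λ (u , v) → k u v + k v u
  S = ∑ (pairs xs) s
  D = ∑ xs (λ y → k y y)
  ρ = ∑ xs (k x)
  κ = ∑ xs (λ u → k u x)

  row+column : ∑ (map (x ,_) xs) s ≡ ρ + κ
  row+column = trans (∑-map (x ,_) s xs) (∑-+ xs (k x) (λ u → k u x))

  regroup : ∀ r c p d q → r + c + p + (d + q) ≡ d + r + (c + (p + q))
  regroup = solve-∀

-- Double counting of adjacent pairs in a graph.

module Counting (G : SimpleGraph) where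
  open SimpleGraph G hiding (order; size; Connected)
  open ≡-Reasoning

  degree-∑ : ∀ v → degree v ≡ ∑ vertices (λ w → ⟦ adj? v w ⟧)
  degree-∑ v = length-filter (adj? v) vertices

  -- `∑-pairs` for `h` weighted by adjacency: symmetry of adjacency gives both orientations of an
  -- edge the same indicator, and irreflexivity kills the diagonal.
  ∑-edges : ∀ (h : V → V → ℕ) →
    ∑ edges (λ (u , v) → h u v + h v u) ≡ ∑ vertices (λ u → ∑ vertices (λ v → ⟦ adj? u v ⟧ * h u v))
  ∑-edges h = begin
    ∑ edges (λ (u , v) → h u v + h v u)
      ≡⟨ ∑-filter (λ (u , v) → adj? u v) (pairs vertices) _ ⟩
    ∑ (pairs vertices) (λ (u , v) → ⟦ adj? u v ⟧ * (h u v + h v u))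
      ≡⟨ ∑-cong (pairs vertices) symmetrise ⟩
    ∑ (pairs vertices) (λ (u , v) → k u v + k v u)
      ≡⟨ +-identityʳ _ ⟨
    ∑ (pairs vertices) (λ (u , v) → k u v + k v u) + 0
      ≡⟨ cong (∑ (pairs vertices) (λ (u , v) → k u v + k v u) +_) diagonal ⟨
    ∑ (pairs vertices) (λ (u , v) → k u v + k v u) + ∑ vertices (λ x → k x x)
      ≡⟨ ∑-pairs vertices k ⟩
    ∑ vertices (λ u → ∑ vertices (k u)) ∎
    where
    k : V → V → ℕ
    k u v = ⟦ adj? u v ⟧ * h u v

    symmetrise : ∀ p → let u = proj₁ p; v = proj₂ p in
                 ⟦ adj? u v ⟧ * (h u v + h v u) ≡ k u v + k v u
    symmetrise (u , v) = trans (*-distribˡ-+ ⟦ adj? u v ⟧ (h u v) (h v u))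
      (cong (λ t → k u v + t * h v u) (⟦⟧-cong (adj? u v) (adj? v u) adj-sym adj-sym))

    diagonal : ∑ vertices (λ x → k x x) ≡ 0
    diagonal = trans
      (∑-cong vertices λ x → cong (_* h x x) (⟦⟧-false (adj? x x) (adj-irrefl refl)))
      (∑-zero vertices)

  -- With a weight that ignores the second vertex, the inner sum of `∑-edges` counts the neighbours
  -- of `u`.
  ∑-ends : ∀ (f : V → ℕ) → ∑ edges (λ (u , v) → f u + f v) ≡ ∑ vertices (λ v → degree v * f v)
  ∑-ends f = trans (∑-edges (λ u _ → f u)) (∑-cong vertices λ u →
    trans (∑-*ʳ vertices (λ v → ⟦ adj? u v ⟧) (f u)) (cong (_* f u) (sym (degree-∑ u))))

  handshake : ∑ vertices degree ≡ 2 * length edges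
  handshake = begin
    ∑ vertices degree                ≡⟨ ∑-cong vertices (λ v → *-identityʳ (degree v)) ⟨
    ∑ vertices (λ v → degree v * 1)  ≡⟨ ∑-ends (λ _ → 1) ⟨
    ∑ edges (λ _ → 2)                ≡⟨ ∑-const edges 2 ⟩
    length edges * 2                 ≡⟨ *-comm (length edges) 2 ⟩
    2 * length edges                 ∎

  source target : E → V
  source e = proj₁ (lookup edges e)
  target e = proj₂ (lookup edges e)

  source-adj-target : ∀ e → Adj (source e) (target e)
  source-adj-target e =
    proj₂ (∈-filter⁻ (λ (u , v) → adj? u v) {xs = pairs vertices} (∈-lookup {xs = edges} e))

  source≢target : ∀ e → source e ≢ target e
  source≢target e eq = adj-irrefl eq (source-adj-target e)

  -- The two ends of an edge differ, so there is no overlap to correct for.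
  isEndOf-∑ : ∀ v e → ⟦ isEndOf? v e ⟧ ≡ ⟦ v ≟ source e ⟧ + ⟦ v ≟ target e ⟧
  isEndOf-∑ v e = ⟦⟧-⊎-disjoint (v ≟ source e) (v ≟ target e)
    λ v≡s v≡t → source≢target e (trans (sym v≡s) v≡t)

  -- This is `∑-ends` for the indicator of `v`; the delta then picks out the degree of `v`.
  ∑-incident : ∀ v → ∑ (allFin (length edges)) (λ e → ⟦ isEndOf? v e ⟧) ≡ degree v
  ∑-incident v = begin
    ∑ (allFin (length edges)) (λ e → ⟦ isEndOf? v e ⟧)
      ≡⟨ ∑-cong (allFin (length edges)) (isEndOf-∑ v) ⟩
    ∑ (allFin (length edges)) (λ e → ⟦ v ≟ source e ⟧ + ⟦ v ≟ target e ⟧)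
      ≡⟨ ∑-lookup edges (λ (a , b) → ⟦ v ≟ a ⟧ + ⟦ v ≟ b ⟧) ⟩
    ∑ edges (λ (a , b) → ⟦ v ≟ a ⟧ + ⟦ v ≟ b ⟧)
      ≡⟨ ∑-ends (λ w → ⟦ v ≟ w ⟧) ⟩
    ∑ vertices (λ w → degree w * ⟦ v ≟ w ⟧)
      ≡⟨ ∑-cong vertices (λ w → *-comm (degree w) ⟦ v ≟ w ⟧) ⟩
    ∑ vertices (λ w → ⟦ v ≟ w ⟧ * degree w)
      ≡⟨ ∑-δ _≟_ degree unique (complete v) ⟩
    degree v ∎

  two-ends : ∀ e → ∑ vertices (λ v → ⟦ isEndOf? v e ⟧) ≡ 2
  two-ends e = begin
    ∑ vertices (λ v → ⟦ isEndOf? v e ⟧)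
      -- The delta lemmas want the fixed vertex on the left of `≟`.
      ≡⟨ ∑-cong vertices (λ v → trans (isEndOf-∑ v e) (cong₂ _+_ (flip≟ v (source e)) (flip≟ v (target e)))) ⟩
    ∑ vertices (λ v → ⟦ source e ≟ v ⟧ + ⟦ target e ≟ v ⟧)
      ≡⟨ ∑-+ vertices (λ v → ⟦ source e ≟ v ⟧) (λ v → ⟦ target e ≟ v ⟧) ⟩
    ∑ vertices (λ v → ⟦ source e ≟ v ⟧) + ∑ vertices (λ v → ⟦ target e ≟ v ⟧)
      ≡⟨ cong₂ _+_ (∑-δ₁ _≟_ unique (complete (source e))) (∑-δ₁ _≟_ unique (complete (target e))) ⟩
    2 ∎
    where
    flip≟ : ∀ v w → ⟦ v ≟ w ⟧ ≡ ⟦ w ≟ v ⟧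
    flip≟ v w = ⟦⟧-cong (v ≟ w) (w ≟ v) sym sym

  module _ {a b : V} (adj : Adj a b) where

    private
      -- The indicator of the ordered pair `(a , b)`, used as weight in `∑-edges`.
      h : V → V → ℕ
      h u v = ⟦ a ≟ u ⟧ * ⟦ b ≟ v ⟧

    -- An edge with ends `a` and `b` carries them in one of two orders. The products placing both at
    -- the same end vanish, because adjacent vertices differ.
    isEndOf-both : ∀ f → ⟦ isEndOf? a f ⟧ * ⟦ isEndOf? b f ⟧ ≡
                         h (source f) (target f) + h (target f) (source f)
    isEndOf-both f = begin
      ⟦ isEndOf? a f ⟧ * ⟦ isEndOf? b f ⟧
        ≡⟨ cong₂ _*_ (isEndOf-∑ a f) (isEndOf-∑ b f) ⟩
      (⟦ a ≟ u ⟧ + ⟦ a ≟ v ⟧) * (⟦ b ≟ u ⟧ + ⟦ b ≟ v ⟧)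
        ≡⟨ expand ⟦ a ≟ u ⟧ ⟦ a ≟ v ⟧ ⟦ b ≟ u ⟧ ⟦ b ≟ v ⟧ ⟩
      h u u + h v v + (h u v + h v u)
        ≡⟨ cong (_+ (h u v + h v u)) (cong₂ _+_ (h-diagonal u) (h-diagonal v)) ⟩
      h u v + h v u ∎
      where
      u = source f
      v = target f

      h-diagonal : ∀ w → h w w ≡ 0
      h-diagonal w = ⟦⟧-disjoint (a ≟ w) (b ≟ w) λ a≡w b≡w → adj-irrefl (trans a≡w (sym b≡w)) adj

      expand : ∀ p q r s → (p + q) * (r + s) ≡ p * r + q * s + (p * s + q * r)
      expand = solve-∀

    -- By `∑-edges` the count equals the number of ordered adjacent pairs equal to `(a , b)`, and
    -- two deltas reduce it to the indicator of `Adj a b`.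
    unique-edge : ∑ (allFin (length edges)) (λ f → ⟦ isEndOf? a f ⟧ * ⟦ isEndOf? b f ⟧) ≡ 1
    unique-edge = begin
      ∑ (allFin (length edges)) (λ f → ⟦ isEndOf? a f ⟧ * ⟦ isEndOf? b f ⟧)
        ≡⟨ ∑-cong (allFin (length edges)) isEndOf-both ⟩
      ∑ (allFin (length edges)) (λ f → h (source f) (target f) + h (target f) (source f))
        ≡⟨ ∑-lookup edges (λ (u , v) → h u v + h v u) ⟩
      ∑ edges (λ (u , v) → h u v + h v u)
        ≡⟨ ∑-edges h ⟩
      ∑ vertices (λ u → ∑ vertices (λ v → ⟦ adj? u v ⟧ * (⟦ a ≟ u ⟧ * ⟦ b ≟ v ⟧)))
        ≡⟨ ∑-cong vertices inner ⟩
      ∑ vertices (λ u → ⟦ a ≟ u ⟧ * ⟦ adj? u b ⟧)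
        ≡⟨ ∑-δ _≟_ (λ u → ⟦ adj? u b ⟧) unique (complete a) ⟩
      ⟦ adj? a b ⟧
        ≡⟨ ⟦⟧-true (adj? a b) adj ⟩
      1 ∎
      where
      swap : ∀ p q r → p * (q * r) ≡ r * (q * p)
      swap = solve-∀

      inner : ∀ u → ∑ vertices (λ v → ⟦ adj? u v ⟧ * (⟦ a ≟ u ⟧ * ⟦ b ≟ v ⟧)) ≡ ⟦ a ≟ u ⟧ * ⟦ adj? u b ⟧
      inner u = trans
        -- The delta at `b` moves to the front, so that the sum over `v` collapses first.
        (∑-cong vertices λ v → swap ⟦ adj? u v ⟧ ⟦ a ≟ u ⟧ ⟦ b ≟ v ⟧)
        (∑-δ _≟_ (λ v → ⟦ a ≟ u ⟧ * ⟦ adj? u v ⟧) unique (complete b))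

  -- Agrees by definition with the adjacency test of `totalGraph` on two inserted vertices.
  adjacentEdge? : (e f : E) → Dec (e ≢ f × ShareEnd e f)
  adjacentEdge? e f = ¬? (e Fin.≟ f) ×-dec shareEnd? e f

  -- An edge f ≠ e meets at most one end of e, while e itself meets both: by
  -- inclusion–exclusion e is counted twice in d(u) + d(v), its neighbours once.
  ∑-adjacentEdge : ∀ e →
    ∑ (allFin (length edges)) (λ f → ⟦ adjacentEdge? e f ⟧) + 2 ≡ degree (source e) + degree (target e)
  ∑-adjacentEdge e = begin
    N + 2
      ≡⟨ +-assoc N 1 1 ⟨
    N + 1 + 1
      -- The first 1 counts the edges equal to `e`, the second those meeting both ends of `e`.
      ≡⟨ cong₂ (λ s t → N + s + t) (∑-δ₁ Fin._≟_ (Unique.allFin⁺ _) (∈-allFin e)) (unique-edge (source-adj-target e)) ⟨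
    N + ∑ I (λ f → ⟦ e Fin.≟ f ⟧) + ∑ I (λ f → α f * β f)
      ≡⟨ cong (_+ ∑ I (λ f → α f * β f)) (∑-+ I (λ f → ⟦ adjacentEdge? e f ⟧) (λ f → ⟦ e Fin.≟ f ⟧)) ⟨
    ∑ I (λ f → ⟦ adjacentEdge? e f ⟧ + ⟦ e Fin.≟ f ⟧) + ∑ I (λ f → α f * β f)
      ≡⟨ cong (_+ ∑ I (λ f → α f * β f)) (∑-cong I λ f → ⟦⟧-remove (e Fin.≟ f) (shareEnd? e f) λ { refl → _ , inj₁ refl , inj₁ refl }) ⟩
    ∑ I (λ f → ⟦ shareEnd? e f ⟧) + ∑ I (λ f → α f * β f)
      ≡⟨ ∑-+ I (λ f → ⟦ shareEnd? e f ⟧) (λ f → α f * β f) ⟨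
    ∑ I (λ f → ⟦ shareEnd? e f ⟧ + α f * β f)
      -- `shareEnd?` is a `map′` of this disjunction and keeps its boolean, so inclusion-exclusion
      -- applies directly.
      ≡⟨ ∑-cong I (λ f → ⟦⟧-⊎ (isEndOf? (source e) f) (isEndOf? (target e) f)) ⟩
    ∑ I (λ f → α f + β f)
      ≡⟨ ∑-+ I α β ⟩
    ∑ I α + ∑ I β
      ≡⟨ cong₂ _+_ (∑-incident (source e)) (∑-incident (target e)) ⟩
    degree (source e) + degree (target e) ∎
    where
    I = allFin (length edges)
    N = ∑ I (λ f → ⟦ adjacentEdge? e f ⟧)
    α β : E → ℕ
    α f = ⟦ isEndOf? (source e) f ⟧
    β f = ⟦ isEndOf? (target e) f ⟧

-- Degrees in the total graph.

module _ (G : SimpleGraph) where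
  open SimpleGraph G hiding (order; size; Connected)
  open Counting G
  open ≡-Reasoning
  private module T = SimpleGraph (totalGraph G)

  degree-totalGraph : ∀ x → T.degree x ≡
    ∑ vertices (λ v → ⟦ T.adj? x (inj₁ v) ⟧) + ∑ (allFin (length edges)) (λ e → ⟦ T.adj? x (inj₂ e) ⟧)
  degree-totalGraph x = trans (Counting.degree-∑ (totalGraph G) x)
    (∑-⊎ (λ y → ⟦ T.adj? x y ⟧) vertices (allFin (length edges)))

  -- The neighbours in `G` and the inserted vertices of incident edges each contribute `degree v`.
  degree-totalGraph-vertex : ∀ v → T.degree (inj₁ v) ≡ 2 * degree v
  degree-totalGraph-vertex v = begin
    T.degree (inj₁ v)    ≡⟨ degree-totalGraph (inj₁ v) ⟩
    _                    ≡⟨ cong₂ _+_ (sym (degree-∑ v)) (∑-incident v) ⟩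
    degree v + degree v  ≡⟨ cong (degree v +_) (+-identityʳ (degree v)) ⟨
    2 * degree v         ∎

  -- The two ends of `e` are neighbours too, and they supply exactly the 2 by which the adjacent
  -- edges fall short of the degree sum.
  degree-totalGraph-edge : ∀ e → T.degree (inj₂ e) ≡ degree (source e) + degree (target e)
  degree-totalGraph-edge e = begin
    T.degree (inj₂ e)                      ≡⟨ degree-totalGraph (inj₂ e) ⟩
    _                                      ≡⟨ cong (_+ N) (two-ends e) ⟩
    2 + N                                  ≡⟨ +-comm 2 N ⟩
    N + 2                                  ≡⟨ ∑-adjacentEdge e ⟩
    degree (source e) + degree (target e)  ∎
    where N = ∑ (allFin (length edges)) (λ f → ⟦ adjacentEdge? e f ⟧)

-- Degrees in the edge T-join.

module _ (G₁ G₂ : SimpleGraph) where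
  open ≡-Reasoning
  private
    module G = SimpleGraph G₁
    module H = SimpleGraph G₂
    module T = SimpleGraph (totalGraph G₁)
    module J = SimpleGraph (G₁ ⊻ᵀ G₂)
    module C = Counting G₁

  degree-⊻ᵀ : ∀ x → J.degree x ≡
    ∑ T.vertices (λ y → ⟦ J.adj? x (inj₁ y) ⟧) + ∑ H.vertices (λ w → ⟦ J.adj? x (inj₂ w) ⟧)
  degree-⊻ᵀ x = trans (Counting.degree-∑ (G₁ ⊻ᵀ G₂) x)
    (∑-⊎ (λ y → ⟦ J.adj? x y ⟧) T.vertices H.vertices)

  degree-⊻ᵀ-vertex : ∀ v → J.degree (inj₁ (inj₁ v)) ≡ 2 * G.degree v
  degree-⊻ᵀ-vertex v = begin
    J.degree (inj₁ (inj₁ v))  ≡⟨ degree-⊻ᵀ (inj₁ (inj₁ v)) ⟩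
    -- `inserted?` computes to `no` here, so `G₂` contributes a sum of zeros.
    _                         ≡⟨ cong₂ _+_ (sym (Counting.degree-∑ (totalGraph G₁) (inj₁ v))) (∑-zero H.vertices) ⟩
    T.degree (inj₁ v) + 0     ≡⟨ +-identityʳ _ ⟩
    T.degree (inj₁ v)         ≡⟨ degree-totalGraph-vertex G₁ v ⟩
    2 * G.degree v            ∎

  degree-⊻ᵀ-edge : ∀ e → J.degree (inj₁ (inj₂ e)) ≡
    G.degree (C.source e) + G.degree (C.target e) + H.order
  degree-⊻ᵀ-edge e = begin
    J.degree (inj₁ (inj₂ e))          ≡⟨ degree-⊻ᵀ (inj₁ (inj₂ e)) ⟩
    -- Here `inserted?` computes to `yes`, so every vertex of `G₂` contributes 1.
    _                                 ≡⟨ cong₂ _+_ (sym (Counting.degree-∑ (totalGraph G₁) (inj₂ e))) (∑-const H.vertices 1) ⟩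
    T.degree (inj₂ e) + H.order * 1   ≡⟨ cong₂ _+_ (degree-totalGraph-edge G₁ e) (*-identityʳ H.order) ⟩
    G.degree (C.source e) + G.degree (C.target e) + H.order ∎

  degree-⊻ᵀ-right : ∀ w → J.degree (inj₂ w) ≡ H.degree w + G.size
  degree-⊻ᵀ-right w = begin
    J.degree (inj₂ w)    ≡⟨ degree-⊻ᵀ (inj₂ w) ⟩
    _                    ≡⟨ cong₂ _+_ joined (sym (Counting.degree-∑ G₂ w)) ⟩
    G.size + H.degree w  ≡⟨ +-comm G.size (H.degree w) ⟩
    H.degree w + G.size  ∎
    where
    joined : ∑ T.vertices (λ y → ⟦ J.adj? (inj₂ w) (inj₁ y) ⟧) ≡ G.size
    joined = begin
      ∑ T.vertices (λ y → ⟦ J.adj? (inj₂ w) (inj₁ y) ⟧)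
        ≡⟨ ∑-⊎ (λ y → ⟦ J.adj? (inj₂ w) (inj₁ y) ⟧) G.vertices (allFin G.size) ⟩
      ∑ G.vertices (λ _ → 0) + ∑ (allFin G.size) (λ _ → 1)
        ≡⟨ cong (_+ ∑ (allFin G.size) (λ _ → 1)) (∑-zero G.vertices) ⟩
      ∑ (allFin G.size) (λ _ → 1)
        -- The edge list has length `G.size` by definition.
        ≡⟨ ∑-lookup G.edges (λ _ → 1) ⟩
      ∑ G.edges (λ _ → 1)
        ≡⟨ ∑-const G.edges 1 ⟩
      G.size * 1
        ≡⟨ *-identityʳ G.size ⟩
      G.size ∎

  F-⊻ᵀ : F (G₁ ⊻ᵀ G₂) ≡
    ∑ G.vertices (λ v → (2 * G.degree v) ^ 3)
      + ∑ G.edges (λ (u , v) → (G.degree u + G.degree v + H.order) ^ 3)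
      + ∑ H.vertices (λ w → (H.degree w + G.size) ^ 3)
  F-⊻ᵀ = begin
    F (G₁ ⊻ᵀ G₂)
      ≡⟨ ∑-⊎ cube T.vertices H.vertices ⟩
    ∑ T.vertices (cube ∘ inj₁) + ∑ H.vertices (cube ∘ inj₂)
      ≡⟨ cong (_+ ∑ H.vertices (cube ∘ inj₂)) (∑-⊎ (cube ∘ inj₁) G.vertices (allFin G.size)) ⟩
    ∑ G.vertices (cube ∘ inj₁ ∘ inj₁) + ∑ (allFin G.size) (cube ∘ inj₁ ∘ inj₂) + ∑ H.vertices (cube ∘ inj₂)
      ≡⟨ cong₂ _+_ (cong₂ _+_
           (∑-cong G.vertices (cong (_^ 3) ∘ degree-⊻ᵀ-vertex))
           (trans (∑-cong (allFin G.size) (cong (_^ 3) ∘ degree-⊻ᵀ-edge)) (∑-lookup G.edges _)))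
           (∑-cong H.vertices (cong (_^ 3) ∘ degree-⊻ᵀ-right)) ⟩
    _ ∎
    where
    cube : J.V → ℕ
    cube x = J.degree x ^ 3

-- Expansion of the three sums of cubes.

module _ (G : SimpleGraph) where
  open SimpleGraph G hiding (order; size; Connected)
  open Counting G
  open ≡-Reasoning

  ∑-doubled-cube : ∑ vertices (λ v → (2 * degree v) ^ 3) ≡ 8 * F G
  ∑-doubled-cube = trans (∑-cong vertices λ v → expand (degree v)) (∑-*ˡ vertices 8 _)
    where
    expand : ∀ d → (2 * d) ^ 3 ≡ 8 * d ^ 3
    expand = solve 1 (λ d → (con 2 :* d) :^ 3 := con 8 :* d :^ 3) refl
      where open +-*-Solver

  -- After the binomial expansion the linear term is evaluated by `handshake`; this is where the
  -- summand with `6 * m₂` originates.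
  ∑-shifted-cube : ∀ m → ∑ vertices (λ v → (degree v + m) ^ 3) ≡
    F G + 3 * m * M₁ G + 3 * m ^ 2 * (2 * length edges) + length vertices * m ^ 3
  ∑-shifted-cube m = begin
    ∑ vertices (λ v → (degree v + m) ^ 3)
      ≡⟨ ∑-cong vertices (λ v → expand (degree v) m) ⟩
    ∑ vertices (λ v → degree v ^ 3 + 3 * m * degree v ^ 2 + 3 * m ^ 2 * degree v + m ^ 3)
      ≡⟨ ∑-+ vertices _ _ ⟩
    ∑ vertices (λ v → degree v ^ 3 + 3 * m * degree v ^ 2 + 3 * m ^ 2 * degree v) + ∑ vertices (λ _ → m ^ 3)
      ≡⟨ cong₂ _+_ (trans (∑-+ vertices _ _) (cong₂ _+_ (∑-+ vertices _ _) refl)) (∑-const vertices (m ^ 3)) ⟩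
    F G + ∑ vertices (λ v → 3 * m * degree v ^ 2) + ∑ vertices (λ v → 3 * m ^ 2 * degree v) + length vertices * m ^ 3
      ≡⟨ cong (_+ length vertices * m ^ 3) (cong₂ _+_
           (cong (F G +_) (∑-*ˡ vertices (3 * m) _))
           (trans (∑-*ˡ vertices (3 * m ^ 2) degree) (cong (3 * m ^ 2 *_) handshake))) ⟩
    F G + 3 * m * M₁ G + 3 * m ^ 2 * (2 * length edges) + length vertices * m ^ 3 ∎
    where
    expand : ∀ d m → (d + m) ^ 3 ≡ d ^ 3 + 3 * m * d ^ 2 + 3 * m ^ 2 * d + m ^ 3
    expand = solve 2 (λ d m → (d :+ m) :^ 3 :=
      d :^ 3 :+ con 3 :* m :* d :^ 2 :+ con 3 :* m :^ 2 :* d :+ m :^ 3) refl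
      where open +-*-Solver

  -- The mixed terms of the cube are grouped as `3 * (x * y * (x + y))` to match `ReZM`. The sums of
  -- `x ^ 3 + y ^ 3` and `x + y` become `M₄` and `M₁` through `∑-ends`.
  ∑-edge-cube : ∀ n → ∑ edges (λ (u , v) → (degree u + degree v + n) ^ 3) ≡
    M₄ G + 3 * ReZM G + 3 * n * HM G + 3 * n ^ 2 * M₁ G + length edges * n ^ 3
  ∑-edge-cube n = begin
    ∑ edges (λ (u , v) → (degree u + degree v + n) ^ 3)
      ≡⟨ ∑-cong edges (λ (u , v) → expand (degree u) (degree v) n) ⟩
    ∑ edges (λ p → c₁ p + 3 * c₂ p + 3 * n * c₃ p + 3 * n ^ 2 * c₄ p + n ^ 3)
      ≡⟨ trans (∑-+ edges _ _) (cong₂ _+_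
          (trans (∑-+ edges _ _) (cong₂ _+_
            (trans (∑-+ edges _ _) (cong₂ _+_
              (trans (∑-+ edges _ _) (cong₂ _+_
                -- `degree v * degree v ^ 3` is `degree v ^ 4` by definition.
                (∑-ends (λ v → degree v ^ 3))
                (∑-*ˡ edges 3 c₂)))
              (∑-*ˡ edges (3 * n) c₃)))
            (trans (∑-*ˡ edges (3 * n ^ 2) c₄) (cong (3 * n ^ 2 *_) ∑c₄≡M₁))))
          (∑-const edges (n ^ 3))) ⟩
    M₄ G + 3 * ReZM G + 3 * n * HM G + 3 * n ^ 2 * M₁ G + length edges * n ^ 3 ∎
    where
    c₁ c₂ c₃ c₄ : V × V → ℕ
    c₁ (u , v) = degree u ^ 3 + degree v ^ 3
    c₂ (u , v) = degree u * degree v * (degree u + degree v)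
    c₃ (u , v) = (degree u + degree v) ^ 2
    c₄ (u , v) = degree u + degree v

    ∑c₄≡M₁ : ∑ edges c₄ ≡ M₁ G
    ∑c₄≡M₁ = trans (∑-ends degree)
      -- The square unfolds to `degree v * (degree v * 1)`.
      (∑-cong vertices λ v → cong (degree v *_) (sym (*-identityʳ (degree v))))

    expand : ∀ x y n → (x + y + n) ^ 3 ≡
      x ^ 3 + y ^ 3 + 3 * (x * y * (x + y)) + 3 * n * (x + y) ^ 2 + 3 * n ^ 2 * (x + y) + n ^ 3
    expand = solve 3 (λ x y n → (x :+ y :+ n) :^ 3 :=
      x :^ 3 :+ y :^ 3 :+ con 3 :* (x :* y :* (x :+ y)) :+ con 3 :* n :* (x :+ y) :^ 2
        :+ con 3 :* n :^ 2 :* (x :+ y) :+ n :^ 3) refl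
      where open +-*-Solver

theorem8 : (G₁ G₂ : SimpleGraph) (n₁ n₂ m₁ m₂ : ℕ) →
    Connected G₁ → Connected G₂ →
    order G₁ ≡ n₁ → order G₂ ≡ n₂ → size G₁ ≡ m₁ → size G₂ ≡ m₂ →
    F (G₁ ⊻ᵀ G₂) ≡
    8 * F G₁ + F G₂ + 3 * n₂ ^ 2 * M₁ G₁ + 3 * m₁ * M₁ G₂ + M₄ G₁
    + 3 * n₂ * HM G₁ + 3 * ReZM G₁ + m₁ ^ 2 * (6 * m₂ + m₁ * n₂) + m₁ * n₂ ^ 3
theorem8 G₁ G₂ _ n m k _ _ _ refl refl refl = begin
  F (G₁ ⊻ᵀ G₂)
    ≡⟨ F-⊻ᵀ G₁ G₂ ⟩
  _
    ≡⟨ cong₂ _+_ (cong₂ _+_ (∑-doubled-cube G₁) (∑-edge-cube G₁ n)) (∑-shifted-cube G₂ m) ⟩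
  _
    ≡⟨ collect (F G₁) (F G₂) (M₁ G₁) (M₁ G₂) (M₄ G₁) (HM G₁) (ReZM G₁) n m k ⟩
  _ ∎
  where
  open ≡-Reasoning

  -- Besides reordering, `3 * m ^ 2 * (2 * k)` and `n * m ^ 3` merge into `m ^ 2 * (6 * k + m * n)`.
  collect : ∀ f f′ μ μ′ μ₄ η ζ n m k →
    8 * f + (μ₄ + 3 * ζ + 3 * n * η + 3 * n ^ 2 * μ + m * n ^ 3)
      + (f′ + 3 * m * μ′ + 3 * m ^ 2 * (2 * k) + n * m ^ 3) ≡
    8 * f + f′ + 3 * n ^ 2 * μ + 3 * m * μ′ + μ₄
      + 3 * n * η + 3 * ζ + m ^ 2 * (6 * k + m * n) + m * n ^ 3
  collect = solve 10 (λ f f′ μ μ′ μ₄ η ζ n m k →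
    con 8 :* f :+ (μ₄ :+ con 3 :* ζ :+ con 3 :* n :* η :+ con 3 :* n :^ 2 :* μ :+ m :* n :^ 3)
      :+ (f′ :+ con 3 :* m :* μ′ :+ con 3 :* m :^ 2 :* (con 2 :* k) :+ n :* m :^ 3) :=
    con 8 :* f :+ f′ :+ con 3 :* n :^ 2 :* μ :+ con 3 :* m :* μ′ :+ μ₄
      :+ con 3 :* n :* η :+ con 3 :* ζ :+ m :^ 2 :* (con 6 :* k :+ m :* n) :+ m :* n :^ 3) refl
    where open +-*-Solver
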